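{- Let $r \ge 2$, $t \ge 2$ and $k \ge 1$ be integers with $k \ge t-3$. Let $G$ be a graph on $n$ vertices, where $$(r-1)(t-1)k < n \le (r-1)(t-1)(k+1),$$ and suppose $$\delta(G) \ge n - \left\lceil \frac{k}{k+1}\left\lceil \frac{n}{r-1}\right\rceil \right\rceil.$$ Then $G \rightarrow (K_r, P_t)$; that is, for every colouring of the edges of $G$ with the two colours red and blue, there is either a red copy of $K_r$ (a complete graph on $r$ vertices all of whose edges are red) or a blue copy of $P_t$ (a path on $t$ vertices all of whose edges are blue).
   Context: $\delta(G)$ denotes the minimum degree of $G$. $K_r$ is the complete graph on $r$ vertices and $P_t$ is the path on $t$ vertices. The notation $G \rightarrow (K_r,P_t)$ means every red/blue edge-colouring of $G$ contains a red $K_r$ or a blue $P_t$ as a subgraph. -}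

module Defs where

open import Data.Fin.Base using (Fin; toℕ)
import Data.Fin.Properties as Fin
open import Data.List.Base using (allFin; filter; length; map)
import Data.List.Extrema.Nat as Extrema
open import Data.Nat.Base using (ℕ; suc; _∸_; _≤_; NonZero; >-nonZero)
import Data.Nat.Properties as ℕ
open import Data.Product.Base using (Σ-syntax; _×_; _,_)
open import Data.Sum.Base using (_⊎_; inj₁; inj₂; swap)
open import Function.Definitions using (Injective)
open import Level using (0ℓ)
open import Relation.Binary.Core using (Rel)
open import Relation.Binary.Definitions
  using (Symmetric; Irreflexive; Decidable; DecidableEquality)
open import Relation.Binary.PropositionalEquality
  using (_≡_; _≢_; refl; sym; trans)
open import Relation.Nullary using (yes; no; ¬?)
open import Relation.Nullary.Decidable using (_⊎-dec_)

record Graph (n : ℕ) : Set₁ where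
  field
    Adj        : Rel (Fin n) 0ℓ
    adj?       : Decidable Adj
    adj-sym    : Symmetric Adj
    adj-irrefl : Irreflexive _≡_ Adj

  degree : Fin n → ℕ
  degree v = length (filter (adj? v) (allFin n))

  -- The default value n exceeds every degree, so it is attained only when
  -- n = 0; for n ≥ 1 this is the minimum over all vertices.
  minDegree : ℕ
  minDegree = Extrema.min n (map degree (allFin n))

open Graph public

δ : ∀ {n} → Graph n → ℕ
δ = minDegree

K : ∀ r → Graph r
K r = record
  { Adj        = _≢_
  ; adj?       = λ i j → ¬? (i Fin.≟ j)
  ; adj-sym    = λ i≢j j≡i → i≢j (sym j≡i)
  ; adj-irrefl = λ i≡j i≢j → i≢j i≡j
  }

-- The path on t vertices (hence t ∸ 1 edges).
P : ∀ t → Graph t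
P t = record
  { Adj        = λ i j → toℕ j ≡ suc (toℕ i) ⊎ toℕ i ≡ suc (toℕ j)
  ; adj?       = λ i j → (toℕ j ℕ.≟ suc (toℕ i)) ⊎-dec (toℕ i ℕ.≟ suc (toℕ j))
  ; adj-sym    = swap
  ; adj-irrefl = λ { refl (inj₁ p) → ℕ.1+n≢n (sym p)
                   ; refl (inj₂ p) → ℕ.1+n≢n (sym p) }
  }

-- A not necessarily induced copy of H in G.
_⊑_ : ∀ {m n} → Graph m → Graph n → Set
_⊑_ {m} {n} H G =
  Σ[ f ∈ (Fin m → Fin n) ]
    Injective _≡_ _≡_ f × (∀ {i j} → Adj H i j → Adj G (f i) (f j))

data Colour : Set where
  red blue : Colour

_≟ᶜ_ : DecidableEquality Colour
red  ≟ᶜ red  = yes refl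
red  ≟ᶜ blue = no λ ()
blue ≟ᶜ red  = no λ ()
blue ≟ᶜ blue = yes refl

-- The law makes the colour a function of the unordered pair {u , v}; applied
-- twice, it also makes it independent of the proof of adjacency.
record Colouring {n} (G : Graph n) : Set where
  field
    colour     : ∀ {u v} → Adj G u v → Colour
    colour-sym : ∀ {u v} (e : Adj G u v) (e′ : Adj G v u) → colour e ≡ colour e′

open Colouring public

-- The spanning subgraph of G formed by the edges of colour c.
colourClass : ∀ {n} {G : Graph n} → Colouring G → Colour → Graph n
colourClass {n} {G} χ c = record
  { Adj        = Adjᶜ
  ; adj?       = adjᶜ?
  ; adj-sym    = λ (e , p) →
      adj-sym G e , trans (colour-sym χ (adj-sym G e) e) p
  ; adj-irrefl = λ u≡v (e , _) → adj-irrefl G u≡v e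
  }
  where
  Adjᶜ : Rel (Fin n) 0ℓ
  Adjᶜ u v = Σ[ e ∈ Adj G u v ] colour χ e ≡ c

  adjᶜ? : Decidable Adjᶜ
  adjᶜ? u v with adj? G u v
  ... | no ¬e = no λ (e , _) → ¬e e
  ... | yes e with colour χ e ≟ᶜ c
  ...   | yes p = yes (e , p)
  ...   | no ¬p = no λ (e′ , p) →
            ¬p (trans (colour-sym χ e (adj-sym G e))
                      (trans (colour-sym χ (adj-sym G e) e′) p))

infix 4 _⊑_ _⟶⟨_,_⟩

_⟶⟨_,_⟩ : ∀ {n a b} → Graph n → Graph a → Graph b → Set
G ⟶⟨ H₁ , H₂ ⟩ =
  (χ : Colouring G) → (H₁ ⊑ colourClass χ red) ⊎ (H₂ ⊑ colourClass χ blue)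

r∸1-nonZero : ∀ {r} → 2 ≤ r → NonZero (r ∸ 1)
r∸1-nonZero 2≤r = >-nonZero (ℕ.∸-monoˡ-≤ 1 2≤r)

{-# OPTIONS --safe #-}
module Submission where

-- Write q = t - 1, R = r - 1, s = ⌈n/R⌉ and σ = s - 1, so R σ < n, and suppose there
-- is no blue path on t vertices.  We show by induction on i that a vertex set W with
-- |W| > i σ contains a red K_{i+1}.  If at most σ vertices of W (one of them w itself)
-- fail to be red neighbours of some w ∈ W, pass to the red neighbourhood of w.
-- A set with large minimum blue degree would contain a long blue path, which settles
-- the case s = q (k + 1).  Otherwise q k < s < q (k + 1), so q ∤ s; each vertex has at
-- most m = s - q other non-neighbours, by k ≥ t - 3; and if the reduction fails, then W
-- has minimum blue degree at least q - 1, so its blue components are cliques of size q.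
-- Reaching the red neighbourhood of w now costs one vertex too many, so |W| ≥ i σ is
-- all that survives.  The loss is recovered as soon as some blue class meets the
-- current set in between 1 and q - 2 vertices.  Because q ∤ m, the non-neighbours of w
-- contain part of a class but not all of it.  If they contain at least two of its
-- vertices, that class does the job in the red neighbourhood of w.  If they always
-- contain exactly one, choose the next vertex in that class: it has a blue degree
-- smaller by one, so nothing further is lost, and the process can be repeated.

open import Defs
open import Data.Nat.Base using (ℕ; suc; _+_; _*_; _∸_; _≤_; _<_; _≥_)
open import Data.Integer.Base as ℤ using (+_)
open import Data.Rational.Unnormalised.Base as ℚᵘ using (_/_; ceiling)

open import Data.Fin.Base as Fin using (Fin; toℕ)
import Data.Fin.Properties as Fin
open import Data.List.Base using (List; []; _∷_; _++_; _∷ʳ_; length; filter; lookup; map; allFin)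
open import Data.List.Membership.Propositional using (_∈_; _∉_; find)
open import Data.List.Membership.Propositional.Properties
  using (∈-∃++; ∈-++⁺ˡ; ∈-++⁺ʳ; ∈-filter⁺; ∈-filter⁻; ∈-lookup; ∈-map⁺; ∈-allFin)
open import Data.List.Properties using (length-++; ++-assoc; ++-identityʳ; length-tabulate)
open import Data.List.Relation.Binary.Permutation.Propositional
  using (_↭_; ↭-sym; ↭-trans; ↭-reflexive; ↭⇒↭ₛ)
open import Data.List.Relation.Binary.Permutation.Propositional.Properties
  using (∈-resp-↭; ↭-length; shift; ∷↭∷ʳ)
import Data.List.Relation.Binary.Permutation.Setoid.Properties as Permutation
open import Data.List.Relation.Binary.Subset.Propositional using (_⊆_)
open import Data.List.Relation.Unary.All as All using (All; []; _∷_)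
open import Data.List.Relation.Unary.AllPairs using (AllPairs; allPairs?; []; _∷_)
open import Data.List.Relation.Unary.Any as Any using (here; there)
open import Data.List.Relation.Unary.Linked using (Linked; linked?; []; [-]; _∷_)
open import Data.List.Relation.Unary.Unique.Propositional using (Unique)
open import Data.List.Relation.Unary.Unique.Propositional.Properties as Unique
  using (Unique[x∷xs]⇒x∉xs)
import Data.Integer.DivMod as ℤDM
import Data.Integer.Properties as ℤ
import Data.Integer.Tactic.RingSolver as ℤRing
import Data.List.Extrema.Nat as Extrema
open import Data.Nat.Base using (zero; z≤n; s≤s; z<s; s<s; s≤s⁻¹)
open import Data.Nat.Divisibility
  using (_∣_; divides; _∣0; ∣m∣n⇒∣m+n; ∣m+n∣m⇒∣n; ∣n⇒∣m*n; ∣-refl; 1∣_; ∣1⇒≡1)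
open import Data.Nat.Induction using (<-wellFounded)
open import Data.Nat.Properties
open import Data.Nat.Tactic.RingSolver using (solve-∀)
open import Data.Product.Base using (∃; ∃₂; _×_; _,_; proj₁; proj₂)
open import Data.Sum.Base using (_⊎_; inj₁; inj₂)
open import Function.Base using (_∘_; id)
open import Induction.WellFounded using (Acc; acc)
open import Level using (0ℓ)
open import Relation.Binary.Core using (Rel)
open import Relation.Binary.Definitions using (Symmetric; Decidable)
open import Relation.Binary.PropositionalEquality
open import Relation.Nullary using (¬_; yes; no; ¬?; Dec; contradiction)
open import Relation.Nullary.Decidable using (map′; _⊎-dec_; _×-dec_; decidable-stable)
open import Relation.Unary as U using (Pred)

-- Counting in duplicate-free lists.

private variable
  A : Set
  x y : A
  xs ys : List A

unique-⊆⇒length≤ : Unique xs → xs ⊆ ys → length xs ≤ length ys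
unique-⊆⇒length≤ {xs = []} _ _ = z≤n
unique-⊆⇒length≤ {xs = x ∷ xs} u@(_ ∷ u′) sub with ∈-∃++ (sub (here refl))
... | ps , qs , refl = ≤-trans (s≤s (unique-⊆⇒length≤ u′ sub′))
                               (≤-reflexive (sym (↭-length (shift x ps qs))))
  where
  sub′ : xs ⊆ ps ++ qs
  sub′ y∈ with ∈-resp-↭ (shift x ps qs) (sub (there y∈))
  ... | here refl = contradiction y∈ (Unique[x∷xs]⇒x∉xs u)
  ... | there y∈′ = y∈′

odd⇒2∣suc : ∀ {m} → ¬ 2 ∣ m → 2 ∣ suc m
odd⇒2∣suc {zero}        odd = contradiction (2 ∣0) odd
odd⇒2∣suc {suc zero}    odd = ∣-refl
odd⇒2∣suc {suc (suc m)} odd = ∣m∣n⇒∣m+n ∣-refl (odd⇒2∣suc (odd ∘ ∣m∣n⇒∣m+n ∣-refl))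

unique-∷ : x ∉ xs → Unique xs → Unique (x ∷ xs)
unique-∷ x∉ u = All.tabulate (λ { y∈ refl → x∉ y∈ }) ∷ u

linked-∷ʳ : {R : Rel A 0ℓ} → Linked R xs → (∀ {y} → y ∈ xs → R y x) → Linked R (xs ∷ʳ x)
linked-∷ʳ []       h = [-]
linked-∷ʳ [-]      h = h (here refl) ∷ [-]
linked-∷ʳ (r ∷ rs) h = r ∷ linked-∷ʳ rs (h ∘ there)

module _ {P Q : Pred A 0ℓ} (P? : U.Decidable P) (Q? : U.Decidable Q) where

  length-filter-cover : Unique xs → (∀ {x} → x ∈ xs → P x ⊎ Q x) →
                        length xs ≤ length (filter P? xs) + length (filter Q? xs)
  length-filter-cover {xs} u h = ≤-trans (unique-⊆⇒length≤ u sub)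
    (≤-reflexive (length-++ (filter P? xs)))
    where
    sub : xs ⊆ filter P? xs ++ filter Q? xs
    sub x∈ with h x∈
    ... | inj₁ p = ∈-++⁺ˡ (∈-filter⁺ P? x∈ p)
    ... | inj₂ q = ∈-++⁺ʳ _ (∈-filter⁺ Q? x∈ q)

  length-filter-mono : Unique xs → xs ⊆ ys → (∀ {x} → x ∈ xs → P x → Q x) →
                       length (filter P? xs) ≤ length (filter Q? ys)
  length-filter-mono u xs⊆ys h = unique-⊆⇒length≤ (Unique.filter⁺ P? u) λ x∈ →
    let x∈xs , px = ∈-filter⁻ P? x∈ in ∈-filter⁺ Q? (xs⊆ys x∈xs) (h x∈xs px)

length-filter-split : {P : Pred A 0ℓ} (P? : U.Decidable P) (xs : List A) →
  length xs ≡ length (filter P? xs) + length (filter (¬? ∘ P?) xs)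
length-filter-split P? [] = refl
length-filter-split P? (x ∷ xs) with P? x
... | yes _ = cong suc (length-filter-split P? xs)
... | no  _ = trans (cong suc (length-filter-split P? xs)) (sym (+-suc _ _))

module _ {n : ℕ} where

  open import Data.List.Membership.DecPropositional (Fin._≟_ {n}) public using (_∈?_)

  unique-escape : {xs ys : List (Fin n)} → Unique ys → length xs < length ys → ∃ λ y → y ∈ ys × y ∉ xs
  unique-escape {xs} {ys} u lt with Any.any? (λ y → ¬? (y ∈? xs)) ys
  ... | yes a = find a
  ... | no ¬a = contradiction (unique-⊆⇒length≤ u λ {y} y∈ →
          decidable-stable (y ∈? xs) λ y∉ → ¬a (Any.map (λ { refl → y∉ }) y∈)) (<⇒≱ lt)

  unique-⊆⇒⊇ : {xs ys : List (Fin n)} → Unique xs → xs ⊆ ys → length ys ≤ length xs → ys ⊆ xs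
  unique-⊆⇒⊇ {xs} u sub le {y} y∈ with y ∈? xs
  ... | yes y∈xs = y∈xs
  ... | no  y∉xs = contradiction
          (unique-⊆⇒length≤ (unique-∷ y∉xs u) λ { (here refl) → y∈ ; (there z∈) → sub z∈ })
          (<⇒≱ (s≤s le))

-- Red cliques, blue paths and the passage to a red neighbourhood.

module Ramsey {n : ℕ} {Red Blue : Rel (Fin n) 0ℓ}
  (red? : Decidable Red) (blue? : Decidable Blue) (blue-sym : Symmetric Blue) where

  private
    V = Fin n
    variable
      u v w : V
      W W′ : List V

  -- `Near v` is the closed blue neighbourhood, so `#near` is the blue degree plus one, and on
  -- disjoint blue cliques `Near` is an equivalence.
  Near Apart : Rel V 0ℓ
  Near v u = v ≡ u ⊎ Blue v u
  Apart v u = ¬ Near v u × ¬ Red v u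

  near? : Decidable Near
  near? v u = (v Fin.≟ u) ⊎-dec blue? v u

  apart? : Decidable Apart
  apart? v u = ¬? (near? v u) ×-dec ¬? (red? v u)

  near-sym : Symmetric Near
  near-sym (inj₁ e) = inj₁ (sym e)
  near-sym (inj₂ b) = inj₂ (blue-sym b)

  #near #apart : V → List V → ℕ
  #near v W = length (filter (near? v) W)
  #apart v W = length (filter (apart? v) W)

  reds : V → List V → List V
  reds v = filter (red? v)

  -- Distinctness of the vertices is recovered from irreflexivity in `clique⇒K⊑`.
  RedClique : ℕ → List V → Set
  RedClique i W = ∃ λ l → length l ≡ i × All (_∈ W) l × AllPairs Red l

  Forces : ℕ → ℕ → Set
  Forces σ i = ∀ {W} → Unique W → i * σ < length W → RedClique (suc i) W

  BluePath : List V → Set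
  BluePath l = Unique l × Linked Blue l

  NoBluePath : ℕ → Set
  NoBluePath t = ∀ {l} → BluePath l → length l ≢ t

  singleton : v ∈ W → RedClique 1 W
  singleton {v} v∈ = v ∷ [] , refl , v∈ ∷ [] , [] ∷ []

  extend-clique : ∀ {i} → v ∈ W → RedClique i (reds v W) → RedClique (suc i) W
  extend-clique {v} {W} v∈ (l , len , l⊆ , pairs) =
    v ∷ l , cong suc len
    , v∈ ∷ All.map (proj₁ ∘ ∈-filter⁻ (red? v) {xs = W}) l⊆
    , All.map (proj₂ ∘ ∈-filter⁻ (red? v) {xs = W}) l⊆ ∷ pairs

  length≤reds+near+apart : Unique W → ∀ v →
    length W ≤ length (reds v W) + (#near v W + #apart v W)
  length≤reds+near+apart {W} uW v =
    ≤-trans (length-filter-cover (red? v) other? uW red⊎other)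
    (+-monoʳ-≤ (length (reds v W))
      (≤-trans (length-filter-cover (near? v) (apart? v) uO (proj₂ ∘ ∈-filter⁻ other? {xs = W}))
        (+-mono-≤ (length-filter-mono (near? v) (near? v) uO O⊆W λ _ → id)
                  (length-filter-mono (apart? v) (apart? v) uO O⊆W λ _ → id))))
    where
    other? = λ u → near? v u ⊎-dec apart? v u
    uO = Unique.filter⁺ other? uW
    O⊆W : filter other? W ⊆ W
    O⊆W = proj₁ ∘ ∈-filter⁻ other?
    red⊎other : u ∈ W → Red v u ⊎ (Near v u ⊎ Apart v u)
    red⊎other {u} _ with red? v u | near? v u
    ... | yes r | _      = inj₁ r
    ... | no  _ | yes k  = inj₂ (inj₁ k)
    ... | no ¬r | no ¬k  = inj₂ (inj₂ (¬k , ¬r))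

  -- The red neighbourhood of w loses only the vertices near or apart, so more than i σ remain; w
  -- extends the red clique found there.
  gain : ∀ {σ i} → Forces σ i → Unique W → w ∈ W →
         #near w W + #apart w W + i * σ < length W → RedClique (2 + i) W
  gain {W} {w} {σ} {i} forces uW w∈ lt = extend-clique w∈ (forces (Unique.filter⁺ (red? w) uW)
    (+-cancelˡ-< (#near w W + #apart w W) _ _ (begin-strict
      #near w W + #apart w W + i * σ             <⟨ lt ⟩
      length W                                   ≤⟨ length≤reds+near+apart uW w ⟩
      length (reds w W) + (#near w W + #apart w W) ≡⟨ +-comm (length (reds w W)) _ ⟩
      #near w W + #apart w W + length (reds w W) ∎)))
    where open ≤-Reasoning

  Dense : ℕ → List V → Set
  Dense ℓ W = ∀ {w} → w ∈ W → ℓ ≤ #near w W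

  sparse⊎dense : ∀ ℓ W → (∃ λ w → w ∈ W × #near w W ≤ ℓ) ⊎ Dense (suc ℓ) W
  sparse⊎dense ℓ W with Any.any? (λ w → #near w W ≤? ℓ) W
  ... | yes a = inj₁ (find a)
  ... | no ¬a = inj₂ λ w∈ → ≰⇒> λ le → ¬a (Any.map (λ { refl → le }) w∈)

  -- A path on fewer than ℓ vertices misses some vertex near its head, hence extends at the front; v
  -- stays on it as its far end.
  greedyPath : ∀ {ℓ} → Unique W → Dense ℓ W → v ∈ W → ∀ {j} → j < ℓ →
    ∃ λ l → BluePath l × length l ≡ suc j × l ⊆ W × v ∈ l
  greedyPath {v = v} uW dense v∈ {zero} _ =
    v ∷ [] , ([] ∷ [] , [-]) , refl , (λ { (here refl) → v∈ }) , here refl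
  greedyPath {W} uW dense v∈ {suc j} j<ℓ with greedyPath uW dense v∈ (<-trans (n<1+n j) j<ℓ)
  ... | x ∷ xs , (uniq , linked) , len , l⊆ , v∈l
    with unique-escape {xs = x ∷ xs} (Unique.filter⁺ (near? x) uW)
           (subst (_< #near x W) (sym len) (<-≤-trans j<ℓ (dense (l⊆ (here refl)))))
  ... | y , y∈ , y∉ with ∈-filter⁻ (near? x) {xs = W} y∈
  ... | _ , inj₁ refl = contradiction (here refl) y∉
  ... | y∈W , inj₂ b =
    y ∷ x ∷ xs , (unique-∷ y∉ uniq , blue-sym b ∷ linked) , cong suc len
    , (λ { (here refl) → y∈W ; (there z∈) → l⊆ z∈ }) , there v∈l

  module _ {m : ℕ} (apart≤ : ∀ v {l} → Unique l → All (Apart v) l → length l ≤ m) where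

    #apart≤ : Unique W → ∀ v → #apart v W ≤ m
    #apart≤ {W} uW v = apart≤ v (Unique.filter⁺ (apart? v) uW)
      (All.tabulate (proj₂ ∘ ∈-filter⁻ (apart? v) {xs = W}))

    -- Without a blue path on ℓ + 1 vertices no set is `Dense (suc ℓ)`, so some w costs at most m +
    -- ℓ ≤ σ. With ℓ = q this serves the case s = q (k + 1).
    forces-sparse : ∀ {σ ℓ} → m + ℓ ≤ σ → NoBluePath (suc ℓ) → ∀ i → Forces σ i
    forces-sparse m+ℓ≤σ noPath zero {x ∷ W} uW _ = singleton (here refl)
    forces-sparse {σ} {ℓ} m+ℓ≤σ noPath (suc i) {x ∷ W} uW lt with sparse⊎dense ℓ (x ∷ W)
    ... | inj₂ dense =
      let l , path , len , _ = greedyPath uW dense (here refl) (n<1+n ℓ)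
      in contradiction len (noPath path)
    ... | inj₁ (w , w∈ , near≤ℓ) = gain (forces-sparse m+ℓ≤σ noPath i) uW w∈ (begin-strict
      #near w (x ∷ W) + #apart w (x ∷ W) + i * σ ≤⟨ +-monoˡ-≤ (i * σ) (+-mono-≤ near≤ℓ (#apart≤ uW w)) ⟩
      ℓ + m + i * σ                              ≡⟨ cong (_+ i * σ) (+-comm ℓ m) ⟩
      m + ℓ + i * σ                              ≤⟨ +-monoˡ-≤ (i * σ) m+ℓ≤σ ⟩
      suc i * σ                                  <⟨ lt ⟩
      length (x ∷ W)                             ∎)
      where open ≤-Reasoning

  -- Blue components of a set with minimum blue degree at least q - 1, where q = p + 1.

  module BlueCliques {p} (noPath : NoBluePath (2 + p))
    {W} (uW : Unique W) (dense : Dense (suc p) W) where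

    module _ {l} (uniq : Unique l) (len : length l ≡ suc p) (l⊆W : l ⊆ W) where

      -- The path cannot be extended, so everything near its head lies on it; at least q vertices
      -- are near, so these are all of it. `l` only fixes the vertex set, while `x ∷ xs` is any
      -- ordering of it as a path.
      head-near : ∀ {x xs} → l ↭ x ∷ xs → Linked Blue (x ∷ xs) →
                  ∀ {u} → u ∈ W → (Near x u → u ∈ l) × (u ∈ l → Near x u)
      head-near {x} {xs} perm linked {u} u∈ =
          (λ k → near⊆l (∈-filter⁺ (near? x) u∈ k))
        , proj₂ ∘ ∈-filter⁻ (near? x) {xs = W} ∘
            unique-⊆⇒⊇ (Unique.filter⁺ (near? x) uW) near⊆l
              (≤-trans (≤-reflexive len) (dense (l⊆W (∈-resp-↭ (↭-sym perm) (here refl)))))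
        where
        uniq′ : Unique (x ∷ xs)
        uniq′ = Permutation.Unique-resp-↭ (setoid V) (↭⇒↭ₛ perm) uniq
        near⊆l : filter (near? x) W ⊆ l
        near⊆l {y} y∈ with ∈-filter⁻ (near? x) {xs = W} y∈
        ... | _ , inj₁ refl = ∈-resp-↭ (↭-sym perm) (here refl)
        ... | _ , inj₂ b = decidable-stable (y ∈? l) λ y∉ →
          noPath (unique-∷ (y∉ ∘ ∈-resp-↭ (↭-sym perm)) uniq′ , blue-sym b ∷ linked)
                 (cong suc (trans (sym (↭-length perm)) len))

      -- The head of a maximal path is joined to all of it, so the path closes up
      -- to a cycle and can be rotated to start at any of its vertices.
      all-near : ∀ xs ys → l ↭ xs ++ ys → Linked Blue (xs ++ ys) → ∀ {y u} → y ∈ xs →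
                 u ∈ W → (Near y u → u ∈ l) × (u ∈ l → Near y u)
      all-near (x ∷ xs) ys perm linked (here refl) u∈ = head-near perm linked u∈
      all-near (x ∷ xs) ys perm linked (there y∈) u∈ =
        all-near xs (ys ∷ʳ x) (↭-trans perm (↭-trans (∷↭∷ʳ x (xs ++ ys)) (↭-reflexive assoc)))
          (subst (Linked Blue) assoc (linked-∷ʳ (Linked-tail linked) closes)) y∈ u∈
        where
        assoc = ++-assoc xs ys (x ∷ [])
        Linked-tail : ∀ {x xs} → Linked Blue (x ∷ xs) → Linked Blue xs
        Linked-tail [-] = []
        Linked-tail (_ ∷ rs) = rs
        closes : ∀ {z} → z ∈ xs ++ ys → Blue z x
        closes z∈ with z∈l ← ∈-resp-↭ (↭-sym perm) (there z∈)
          with proj₂ (head-near perm linked (l⊆W z∈l)) z∈l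
        ... | inj₂ b = blue-sym b
        ... | inj₁ refl = contradiction z∈ (Unique[x∷xs]⇒x∉xs
                (Permutation.Unique-resp-↭ (setoid V) (↭⇒↭ₛ perm) uniq))

    -- The blue class of v is the vertex set of any blue path on q vertices of W through v.
    class : v ∈ W → ∃ λ l → length l ≡ suc p × l ⊆ W × v ∈ l ×
            (∀ {y u} → y ∈ l → u ∈ W → (Near y u → u ∈ l) × (u ∈ l → Near y u))
    class v∈ with greedyPath uW dense v∈ (n<1+n p)
    ... | l , (uniq , linked) , len , l⊆ , v∈l = l , len , l⊆ , v∈l ,
      all-near uniq len l⊆ l [] (↭-reflexive (sym (++-identityʳ l)))
        (subst (Linked Blue) (sym (++-identityʳ l)) linked)

    near-trans : v ∈ W → u ∈ W → w ∈ W → Near v u → Near u w → Near v w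
    near-trans v∈ u∈ w∈ vu uw with class v∈
    ... | l , _ , _ , v∈l , h = proj₂ (h v∈l w∈) (proj₁ (h (proj₁ (h v∈l u∈) vu) w∈) uw)

    #near≡ : v ∈ W → #near v W ≡ suc p
    #near≡ {v} v∈ with class v∈
    ... | l , len , _ , v∈l , h = ≤-antisym (subst (_ ≤_) len
      (unique-⊆⇒length≤ (Unique.filter⁺ (near? v) uW) λ u∈ →
        let u∈W , k = ∈-filter⁻ (near? v) u∈ in proj₁ (h v∈l u∈W) k)) (dense v∈)

    -- A witness that S is not a union of blue classes: the class of x meets S but also has a vertex
    -- y outside it.
    Leak : List V → Set
    Leak S = ∃₂ λ x y → x ∈ S × y ∈ W × Near x y × y ∉ S

    leak? : ∀ S → Dec (Leak S)
    leak? S = Fin.any? λ x → Fin.any? λ y →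
      (x ∈? S) ×-dec (y ∈? W) ×-dec near? x y ×-dec ¬? (y ∈? S)

    -- S is a union of classes of size q: strip the class of its first vertex and recurse. By
    -- transitivity of `Near` the remainder has no leak either.
    closed⇒∣ : ∀ {S} → Unique S → S ⊆ W → ¬ Leak S → Acc _<_ (length S) → suc p ∣ length S
    closed⇒∣ {[]} _ _ _ _ = _ ∣0
    closed⇒∣ {S@(x ∷ S′)} uS S⊆ closed (acc rec) = subst (suc p ∣_)
      (sym (length-filter-split (near? x) S))
      (∣m∣n⇒∣m+n (subst (suc p ∣_) (sym #≡) ∣-refl)
                 (closed⇒∣ (Unique.filter⁺ far? uS) (S⊆ ∘ proj₁ ∘ ∈-filter⁻ far?) closed′ (rec smaller)))
      where
      x∈W = S⊆ (here refl)
      far? = ¬? ∘ near? x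
      closed∈ : ∀ {a b} → a ∈ S → b ∈ W → Near a b → b ∈ S
      closed∈ {a} {b} a∈ b∈ k = decidable-stable (b ∈? S) λ b∉ → closed (a , b , a∈ , b∈ , k , b∉)
      #≡ : length (filter (near? x) S) ≡ suc p
      #≡ = ≤-antisym
        (≤-trans (length-filter-mono (near? x) (near? x) uS S⊆ λ _ → id) (≤-reflexive (#near≡ x∈W)))
        (≤-trans (≤-reflexive (sym (#near≡ x∈W))) (unique-⊆⇒length≤ (Unique.filter⁺ (near? x) uW)
           λ b∈ → let b∈W , k = ∈-filter⁻ (near? x) {xs = W} b∈
                  in ∈-filter⁺ (near? x) (closed∈ (here refl) b∈W k) k))
      closed′ : ¬ Leak (filter far? S)
      closed′ (a , b , a∈ , b∈ , k , b∉) with ∈-filter⁻ far? {xs = S} a∈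
      ... | a∈S , ¬xa = b∉ (∈-filter⁺ far? (closed∈ a∈S b∈ k)
        λ xb → ¬xa (near-trans x∈W b∈ (S⊆ a∈S) xb (near-sym k)))
      smaller : length (filter far? S) < length S
      smaller = subst (length (filter far? S) <_)
        (sym (trans (length-filter-split (near? x) S) (cong (_+ length (filter far? S)) #≡)))
        (s≤s (m≤n+m _ p))

    leak⊎∣ : ∀ {S} → Unique S → S ⊆ W → Leak S ⊎ suc p ∣ length S
    leak⊎∣ {S} uS S⊆ with leak? S
    ... | yes leak = inj₁ leak
    ... | no closed = inj₂ (closed⇒∣ uS S⊆ closed (<-wellFounded _))

  -- The induction when q = p + 1 does not divide m.

  module CliqueCase {m p} (apart≤ : ∀ v {l} → Unique l → All (Apart v) l → length l ≤ m)
    (noPath : NoBluePath (2 + p)) (q∤m : ¬ suc p ∣ m) where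

    -- This is the largest loss m + (q - 1) at a vertex near at most q - 1 vertices; inside blue
    -- q-cliques the loss can reach σ + 1.
    σ : ℕ
    σ = m + p

    ForcesBelow : ℕ → Set
    ForcesBelow i = ∀ {j} → j < i → Forces σ j

    -- The lost vertex is recovered here: w costs at most σ - 1, so the weak inequality on |W|
    -- leaves a strict one in its red neighbourhood.
    small-class : ∀ {i} → ForcesBelow i → Unique W → w ∈ W → #near w W < p →
                  i * σ ≤ length W → RedClique (suc i) W
    small-class {i = zero} _ _ w∈ _ _ = singleton w∈
    small-class {W} {w} {i = suc i} forces uW w∈ near<p le =
      gain (forces (n<1+n i)) uW w∈ (begin-strict
        #near w W + #apart w W + i * σ
          <⟨ +-monoˡ-< (i * σ) (+-mono-<-≤ near<p (#apart≤ apart≤ uW w)) ⟩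
        p + m + i * σ ≡⟨ cong (_+ i * σ) (+-comm p m) ⟩
        suc i * σ     ≤⟨ le ⟩
        length W      ∎)
      where open ≤-Reasoning

    module _ {W} (uW : Unique W) (dense : Dense (suc p) W) where

      open BlueCliques noPath uW dense

      -- The class of x keeps y in the red neighbourhood of v but loses at least two vertices, so
      -- between 1 and q - 2 of them survive.
      PartlyApart : V → V → V → Set
      PartlyApart v x y = v ∈ W × x ∈ W × y ∈ W × Near x y × Red v y × Apart v x
                        × 1 < #apart v (filter (near? x) W)

      partlyApart? : Dec (∃ λ v → ∃ λ x → ∃ λ y → PartlyApart v x y)
      partlyApart? = Fin.any? λ v → Fin.any? λ x → Fin.any? λ y →
        (v ∈? W) ×-dec (x ∈? W) ×-dec (y ∈? W) ×-dec near? x y ×-dec red? v y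
        ×-dec apart? v x ×-dec (1 <? #apart v (filter (near? x) W))

      -- The red neighbourhood of v costs at most m + q = σ + 1 vertices, which leaves just enough
      -- for `small-class` at y.
      partlyApart⇒clique : ∀ {i v x y} → ForcesBelow i → PartlyApart v x y →
                           i * σ < length W → RedClique (suc i) W
      partlyApart⇒clique {zero} _ (v∈ , _) _ = singleton v∈
      partlyApart⇒clique {suc i} {v} {x} {y} forces (v∈ , x∈ , y∈ , xy , vy , _ , two) lt =
        extend-clique v∈ (small-class (forces ∘ m<n⇒m<1+n) uR (∈-filter⁺ (red? v) y∈ vy) near<p le)
        where
        open ≤-Reasoning
        uR = Unique.filter⁺ (red? v) uW
        F = filter (near? x) W
        present? = ¬? ∘ apart? v
        near≤ : #near y (reds v W) ≤ length (filter present? F)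
        near≤ = unique-⊆⇒length≤ (Unique.filter⁺ (near? y) uR) λ u∈ →
          let u∈R , yu = ∈-filter⁻ (near? y) {xs = reds v W} u∈
              u∈W , vu = ∈-filter⁻ (red? v) {xs = W} u∈R
          in ∈-filter⁺ present? (∈-filter⁺ (near? x) u∈W (near-trans x∈ y∈ u∈W xy yu))
               λ (_ , ¬vu) → ¬vu vu
        near<p : #near y (reds v W) < p
        near<p = s≤s⁻¹ (begin
          2 + #near y (reds v W)                      ≤⟨ +-mono-≤ two near≤ ⟩
          #apart v F + length (filter present? F)     ≡⟨ length-filter-split (apart? v) F ⟨
          length F                                    ≡⟨ #near≡ x∈ ⟩
          suc p                                       ∎)
        le : i * σ ≤ length (reds v W)
        le = +-cancelˡ-≤ (suc (m + p)) _ _ (begin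
          suc (m + p) + i * σ                            ≤⟨ lt ⟩
          length W                                       ≤⟨ length≤reds+near+apart uW v ⟩
          length (reds v W) + (#near v W + #apart v W)
            ≤⟨ +-monoʳ-≤ (length (reds v W)) (+-mono-≤ (≤-reflexive (#near≡ v∈)) (#apart≤ apart≤ uW v)) ⟩
          length (reds v W) + (suc p + m)                ≡⟨ +-comm (length (reds v W)) _ ⟩
          suc p + m + length (reds v W)                  ≡⟨ cong (λ a → suc a + length (reds v W)) (+-comm p m) ⟩
          suc (m + p) + length (reds v W)                ∎)

      -- With L = |W′| and a = `#near w W′` this unfolds the invariant of `chain`: since σ = m + q -
      -- 1, at least i σ vertices survive even if m are apart from w.
      room : ∀ a i {L} → suc i * σ + a < L + suc p → a + m + i * σ ≤ L
      room a i lt = +-cancelʳ-≤ (suc p) _ _ (≤-trans (≤-reflexive (rearrange a m (i * σ) p)) lt)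
        where
        rearrange : ∀ a m s p → a + m + s + suc p ≡ suc (m + p + s + a)
        rearrange = solve-∀

      -- Since q ∤ m, the m vertices apart from w split some class, and they miss all
      -- but one of its vertices; the red neighbourhood of w then meets that class in
      -- at most q ∸ 1 vertices, which is where the next vertex is chosen.
      chain : (∀ {v x y} → ¬ PartlyApart v x y) → 1 < p → ∀ i → ForcesBelow i →
              Unique W′ → W′ ⊆ W → w ∈ W′ → i * σ ≤ length W′ →
              i * σ + #near w W′ < length W′ + suc p → RedClique (suc i) W′
      chain _ _ zero _ _ _ w∈ _ _ = singleton w∈
      chain {W′} {w} whole 1<p (suc i) forces uW′ W′⊆W w∈ le lt with #apart w W′ <? m
      -- One apart vertex fewer makes up for the lost one.
      ... | yes a<m = gain (forces (n<1+n i)) uW′ w∈ (<-≤-trans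
              (+-monoˡ-< (i * σ) (+-monoʳ-< (#near w W′) a<m)) (room (#near w W′) i lt))
      ... | no a≮m with leak⊎∣ (Unique.filter⁺ (apart? w) uW′) (W′⊆W ∘ proj₁ ∘ ∈-filter⁻ (apart? w))
      ...   | inj₂ q∣ = contradiction (subst (suc p ∣_) (≤-antisym (#apart≤ apart≤ uW′ w) (≮⇒≥ a≮m)) q∣) q∤m
      ...   | inj₁ (x , y , x∈S , y∈W , xy , y∉S) =
        next (Fin.any? λ u → (u ∈? reds w W′) ×-dec near? x u)
        where
        open ≤-Reasoning
        S = filter (apart? w) W′
        uS = Unique.filter⁺ (apart? w) uW′
        uR = Unique.filter⁺ (red? w) uW′
        x∈W′ = proj₁ (∈-filter⁻ (apart? w) {xs = W′} x∈S)
        wx = proj₂ (∈-filter⁻ (apart? w) {xs = W′} x∈S)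
        x∈W = W′⊆W x∈W′
        w∈W = W′⊆W w∈
        R⊆W : reds w W′ ⊆ W
        R⊆W = W′⊆W ∘ proj₁ ∘ ∈-filter⁻ (red? w)
        -- y is not near w, since x is near y but apart from w. Were it not red either, `S` and y
        -- would be m + 1 vertices apart from w. Note that y may lie outside `W′`.
        wy : Red w y
        wy = decidable-stable (red? w y) λ ¬wy →
          a≮m (apart≤ w (unique-∷ y∉S uS)
            (((λ wy → proj₁ wx (near-trans w∈W y∈W x∈W wy (near-sym xy))) , ¬wy)
             ∷ All.tabulate (proj₂ ∘ ∈-filter⁻ (apart? w) {xs = W′})))
        apart≤1 : #apart w (filter (near? x) W) ≤ 1
        apart≤1 = ≮⇒≥ λ two → whole (w∈W , x∈W , y∈W , xy , wy , wx , two)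
        le′ : i * σ ≤ length (reds w W′)
        le′ = +-cancelˡ-≤ (#near w W′ + m) _ _ (begin
          #near w W′ + m + i * σ
            ≤⟨ room (#near w W′) i lt ⟩
          length W′ ≤⟨ length≤reds+near+apart uW′ w ⟩
          length (reds w W′) + (#near w W′ + #apart w W′)
            ≤⟨ +-monoʳ-≤ (length (reds w W′)) (+-monoʳ-≤ (#near w W′) (#apart≤ apart≤ uW′ w)) ⟩
          length (reds w W′) + (#near w W′ + m) ≡⟨ +-comm (length (reds w W′)) _ ⟩
          #near w W′ + m + length (reds w W′) ∎)
        next : Dec (∃ λ u → u ∈ reds w W′ × Near x u) → RedClique (2 + i) W′
        -- u lies in the class of x, whose vertex x is no longer present; so u is near at most q - 1
        -- vertices and the invariant holds again.
        next (yes (u , u∈R , xu)) = extend-clique w∈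
          (chain whole 1<p i (forces ∘ m<n⇒m<1+n) uR R⊆W u∈R le′ (+-mono-≤-< le′ near<))
          where
          x∉R : x ∉ filter (near? u) (reds w W′)
          x∉R x∈ = proj₂ wx (proj₂ (∈-filter⁻ (red? w) {xs = W′} (proj₁ (∈-filter⁻ (near? u) {xs = reds w W′} x∈))))
          near< : #near u (reds w W′) < suc p
          near< = ≤-trans
            (unique-⊆⇒length≤ (unique-∷ x∉R (Unique.filter⁺ (near? u) uR))
              λ { (here refl) → ∈-filter⁺ (near? x) x∈W (inj₁ refl)
                ; (there z∈) → let z∈R , uz = ∈-filter⁻ (near? u) {xs = reds w W′} z∈ in
                    ∈-filter⁺ (near? x) (R⊆W z∈R) (near-trans x∈W (R⊆W u∈R) (R⊆W z∈R) xu uz) })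
            (≤-reflexive (#near≡ x∈W))
        -- Every vertex of `W′` near x is apart from w, so there is at most one, and `small-class`
        -- applies in `W′` itself.
        next (no none) = small-class forces uW′ x∈W′ (≤-<-trans (≤-trans near≤ apart≤1) 1<p) le
          where
          near≤ : #near x W′ ≤ #apart w (filter (near? x) W)
          near≤ = unique-⊆⇒length≤ (Unique.filter⁺ (near? x) uW′) λ u∈ →
            let u∈W′ , xu = ∈-filter⁻ (near? x) {xs = W′} u∈ in
            ∈-filter⁺ (apart? w) (∈-filter⁺ (near? x) (W′⊆W u∈W′) xu)
              ( (λ wu → proj₁ wx (near-trans w∈W (W′⊆W u∈W′) x∈W wu (near-sym xu)))
              , (λ wu → none (_ , ∈-filter⁺ (red? w) u∈W′ wu , xu)))

    forces-step : ∀ i → ForcesBelow i → Forces σ i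
    forces-step zero _ {x ∷ W} _ _ = singleton (here refl)
    forces-step (suc i) forces {W@(x ∷ _)} uW lt with sparse⊎dense p W
    ... | inj₁ (w , w∈ , near≤p) = gain (forces (n<1+n i)) uW w∈
      (≤-<-trans (≤-trans (+-monoˡ-≤ (i * σ) (+-mono-≤ near≤p (#apart≤ apart≤ uW w)))
                          (≤-reflexive (cong (_+ i * σ) (+-comm p m)))) lt)
    ... | inj₂ dense = by-class-size p refl
      where
      open BlueCliques noPath uW dense
      q∣W : suc p ∣ length W
      q∣W with leak⊎∣ uW id
      ... | inj₁ (_ , _ , _ , y∈ , _ , y∉) = contradiction y∈ y∉
      ... | inj₂ q∣ = q∣
      -- The copy p′ permits a case split on the module parameter p.
      by-class-size : ∀ p′ → p′ ≡ p → RedClique (2 + i) W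
      by-class-size 0 refl = contradiction (1∣ m) q∤m
      -- For blue edges as classes, σ is even and so is the number of vertices,
      -- which therefore exceeds (1 + i) σ by at least two.
      by-class-size 1 refl = gain (forces (n<1+n i)) uW (here refl) (begin-strict
        #near x W + #apart x W + i * σ
          ≤⟨ +-monoˡ-≤ (i * σ) (+-mono-≤ (≤-reflexive (#near≡ (here refl))) (#apart≤ apart≤ uW x)) ⟩
        2 + m + i * σ      ≡⟨ cong (λ a → suc (a + i * σ)) (+-comm 1 m) ⟩
        suc (suc i * σ)    <⟨ ≤∧≢⇒< lt odd≢ ⟩
        length W           ∎)
        where
        open ≤-Reasoning
        odd≢ : suc (suc i * σ) ≢ length W
        odd≢ eq = contradiction (∣1⇒≡1 (∣m+n∣m⇒∣n
          (subst (2 ∣_) (trans (sym eq) (+-comm 1 (suc i * σ))) q∣W)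
          (∣n⇒∣m*n (suc i) (subst (2 ∣_) (+-comm 1 m) (odd⇒2∣suc q∤m))))) λ ()
      by-class-size (suc (suc _)) refl with partlyApart? uW dense
      ... | yes (_ , _ , _ , bad) = partlyApart⇒clique uW dense forces bad lt
      ... | no none = chain uW dense (λ bad → none (_ , _ , _ , bad)) (s<s z<s) (suc i) forces
              uW id (here refl) (<⇒≤ lt)
              (+-mono-<-≤ lt (≤-reflexive (#near≡ (here refl))))

    forces-dense : ∀ i → Forces σ i
    forces-dense i {W} = forces-step i (below i)
      where
      below : ∀ i → ForcesBelow i
      below (suc i) j<1+i with m≤n⇒m<n∨m≡n (s≤s⁻¹ j<1+i)
      ... | inj₁ j<i = below i j<i
      ... | inj₂ refl = forces-step i (below i)

-- From lists of vertices to copies of graphs.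

-- Exhaustive search, used to decide constructively whether a blue path on t vertices exists.
any-ofLength? : ∀ {n} t {P : List (Fin n) → Set} → (∀ l → Dec (P l)) →
                Dec (∃ λ l → length l ≡ t × P l)
any-ofLength? zero P? = map′ (λ p → [] , refl , p) (λ { ([] , refl , p) → p }) (P? [])
any-ofLength? (suc t) P? = map′
  (λ (x , l , len , p) → x ∷ l , cong suc len , p)
  (λ { (x ∷ l , len , p) → x , l , suc-injective len , p })
  (Fin.any? λ x → any-ofLength? t (P? ∘ (x ∷_)))

allPairs-lookup : {R : Rel A 0ℓ} → Symmetric R → AllPairs R xs →
                  ∀ {i j} → i ≢ j → R (lookup xs i) (lookup xs j)
allPairs-lookup s (_  ∷ _)  {Fin.zero}  {Fin.zero}  i≢j = contradiction refl i≢j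
allPairs-lookup s (rs ∷ _)  {Fin.zero}  {Fin.suc j} _   = All.lookup rs (∈-lookup j)
allPairs-lookup s (rs ∷ _)  {Fin.suc i} {Fin.zero}  _   = s (All.lookup rs (∈-lookup i))
allPairs-lookup s (_  ∷ ps) {Fin.suc i} {Fin.suc j} i≢j = allPairs-lookup s ps (i≢j ∘ cong Fin.suc)

linked-lookup : {R : Rel A 0ℓ} → Linked R xs →
                ∀ {i j} → toℕ j ≡ suc (toℕ i) → R (lookup xs i) (lookup xs j)
linked-lookup (r ∷ _)  {Fin.zero}  {Fin.suc Fin.zero} refl = r
linked-lookup (_ ∷ rs) {Fin.suc i} {Fin.suc j}        eq   = linked-lookup rs (suc-injective eq)

clique⇒K⊑ : ∀ {n r} (H : Graph n) {l} → length l ≡ r → AllPairs (Adj H) l → K r ⊑ H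
clique⇒K⊑ H {l} refl pairs = lookup l
  , (λ {i} {j} eq → decidable-stable (i Fin.≟ j) λ i≢j →
      adj-irrefl H eq (allPairs-lookup (adj-sym H) pairs i≢j))
  , allPairs-lookup (adj-sym H) pairs

path⇒P⊑ : ∀ {n t} (H : Graph n) {l} → length l ≡ t → Unique l → Linked (Adj H) l → P t ⊑ H
path⇒P⊑ H {l} refl uniq linked = lookup l
  , (λ {i} {j} eq → decidable-stable (i Fin.≟ j) λ i≢j →
      allPairs-lookup (_∘ sym) uniq i≢j eq)
  , λ { (inj₁ e) → linked-lookup linked e
      ; (inj₂ e) → adj-sym H (linked-lookup linked e) }

-- Ceilings, minimum degree and the choice of parameters.

-- `ceiling` is the negated floor of the negation: -a = ρ + fl D with 0 ≤ ρ < D gives a + ρ = s D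
-- for s = -fl, whence s ≥ 0 and both bounds.
ceiling-bounds : ∀ a d → ∃ λ s → ceiling (+ a / suc d) ≡ + s × a ≤ s * suc d × s * suc d < a + suc d
ceiling-bounds a d = nonneg (ceiling (+ a / suc d)) refl
  where
  D = + suc d
  fl = ℤ.- (+ a) ℤDM./ D
  ρ = ℤ.- (+ a) ℤDM.% D
  ρ<D : ρ < suc d
  ρ<D = ℤDM.n%d<d (ℤ.- (+ a)) D
  a+ρ≡ : + (a + ρ) ≡ ℤ.- fl ℤ.* D
  a+ρ≡ = begin
    + a ℤ.+ + ρ                              ≡⟨ ℤsolve (+ a) (+ ρ) (fl ℤ.* D) ⟩
    + a ℤ.+ (+ ρ ℤ.+ fl ℤ.* D) ℤ.- fl ℤ.* D   ≡⟨ cong (λ z → + a ℤ.+ z ℤ.- fl ℤ.* D) (ℤDM.a≡a%n+[a/n]*n (ℤ.- (+ a)) D) ⟨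
    + a ℤ.+ ℤ.- (+ a) ℤ.- fl ℤ.* D            ≡⟨ cong (ℤ._- fl ℤ.* D) (ℤ.+-inverseʳ (+ a)) ⟩
    + 0 ℤ.- fl ℤ.* D                          ≡⟨ ℤ.+-identityˡ _ ⟩
    ℤ.- (fl ℤ.* D)                            ≡⟨ ℤ.neg-distribˡ-* fl D ⟩
    ℤ.- fl ℤ.* D                              ∎
    where
    open ≡-Reasoning
    ℤsolve : ∀ x y z → x ℤ.+ y ≡ x ℤ.+ (y ℤ.+ z) ℤ.- z
    ℤsolve = ℤRing.solve-∀
  nonneg : ∀ z → z ≡ ℤ.- fl → ∃ λ s → ℤ.- fl ≡ + s × a ≤ s * suc d × s * suc d < a + suc d
  nonneg (+ s) eq = s , sym eq , subst (a ≤_) a+ρ≡sD (m≤m+n a ρ)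
                  , subst (_< a + suc d) a+ρ≡sD (+-monoʳ-< a ρ<D)
    where
    a+ρ≡sD : a + ρ ≡ s * suc d
    a+ρ≡sD = ℤ.+-injective (trans a+ρ≡ (trans (cong (ℤ._* D) (sym eq)) (sym (ℤ.pos-* s (suc d)))))
  nonneg (ℤ.-[1+ s ]) eq = contradiction (trans a+ρ≡ (cong (ℤ._* D) (sym eq))) λ ()

module _ {n : ℕ} (G : Graph n) where

  δ≤degree : ∀ v → δ G ≤ degree G v
  δ≤degree v = All.lookup (Extrema.min≤xs n (map (degree G) (allFin n))) (∈-map⁺ (degree G) (∈-allFin v))

  -- The inequality is strict because v itself is among its non-neighbours.
  nonadjacent-bound : ∀ {c v l} → n ≤ δ G + c → Unique l → All (λ u → v ≢ u × ¬ Adj G v u) l →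
                      length l < c
  nonadjacent-bound {c} {v} {l} n≤ uniq apart = +-cancelˡ-≤ (degree G v) _ _ (begin
    degree G v + suc (length l)
      ≤⟨ +-monoʳ-≤ (degree G v) (unique-⊆⇒length≤ (All.map proj₁ apart ∷ uniq) sub) ⟩
    degree G v + length (filter (¬? ∘ adj? G v) (allFin n))
      ≡⟨ length-filter-split (adj? G v) (allFin n) ⟨
    length (allFin n) ≡⟨ length-tabulate id ⟩
    n                 ≤⟨ n≤ ⟩
    δ G + c           ≤⟨ +-monoˡ-≤ c (δ≤degree v) ⟩
    degree G v + c    ∎)
    where
    open ≤-Reasoning
    sub : v ∷ l ⊆ filter (¬? ∘ adj? G v) (allFin n)
    sub (here refl) = ∈-filter⁺ (¬? ∘ adj? G v) (∈-allFin _) (adj-irrefl G refl)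
    sub (there u∈) = ∈-filter⁺ (¬? ∘ adj? G v) (∈-allFin _) (proj₂ (All.lookup apart u∈))

-- R and q stand for r ∸ 1 and t ∸ 1, and s and c for the two ceilings
-- ⌈ n / R ⌉ and ⌈ k s / (k + 1) ⌉, of which only the stated bounds matter.
module _ (R′ p k′ n : ℕ) (p≤1+k : p ≤ suc (suc k′)) where

  private
    R = suc R′
    q = suc p
    k = suc k′

  arrows-from-bounds : (G : Graph n) → R * q * k < n → n ≤ R * q * (k + 1) →
    (s c : ℕ) → n ≤ s * R → s * R < n + R → c * suc k < k * s + suc k → n ≤ δ G + c →
    G ⟶⟨ K (suc R) , P (suc q) ⟩
  arrows-from-bounds G lo hi s c n≤sR sR< c< n≤δ+c χ
    with any-ofLength? (suc q) {λ l → Unique l × Linked (Adj (colourClass χ blue)) l}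
           (λ l → allPairs? (λ x y → ¬? (x Fin.≟ y)) l ×-dec linked? (adj? (colourClass χ blue)) l)
  ... | yes (l , len , uniq , linked) = inj₂ (path⇒P⊑ (colourClass χ blue) len uniq linked)
  ... | no none = inj₁ (to-K (red-clique (s <? q * suc k)))
    where
    H = colourClass χ
    open Ramsey (adj? (H red)) (adj? (H blue)) (adj-sym (H blue))

    noPath : NoBluePath (suc q)
    noPath path len = none (_ , len , path)

    to-K : RedClique (suc R) (allFin n) → K (suc R) ⊑ H red
    to-K (l , len , _ , pairs) = clique⇒K⊑ (H red) len pairs

    apart<c : ∀ v {l} → Unique l → All (Apart v) l → length l < c
    apart<c v uniq apart = nonadjacent-bound G n≤δ+c uniq
      (All.map (λ (¬near , ¬red) → ¬near ∘ inj₁ , nonadjacent ¬near ¬red) apart)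
      where
      nonadjacent : ∀ {u} → ¬ Near v u → ¬ Adj (H red) v u → ¬ Adj G v u
      nonadjacent ¬near ¬red e with colour χ e in eq
      ... | red  = ¬red (e , eq)
      ... | blue = ¬near (inj₂ (e , eq))

    qk<s : q * k < s
    qk<s = *-cancelˡ-< R _ _ (begin-strict
      R * (q * k) ≡⟨ *-assoc R q k ⟨
      R * q * k   <⟨ lo ⟩
      n           ≤⟨ n≤sR ⟩
      s * R       ≡⟨ *-comm s R ⟩
      R * s       ∎)
      where open ≤-Reasoning

    s≤ : s ≤ q * suc k
    s≤ = s≤s⁻¹ (*-cancelʳ-< R s (suc (q * suc k)) (begin-strict
      s * R                       <⟨ sR< ⟩
      n + R                       ≤⟨ +-monoˡ-≤ R hi ⟩
      R * q * (k + 1) + R         ≡⟨ rearrange R q k ⟩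
      suc (q * suc k) * R         ∎))
      where
      open ≤-Reasoning
      rearrange : ∀ R q k → R * q * (k + 1) + R ≡ suc (q * suc k) * R
      rearrange = solve-∀

    -- The bound s R < n + R amounts to R (s - 1) < n.
    from-forces : ∀ {σ} → suc σ ≡ s → Forces σ R → RedClique (suc R) (allFin n)
    from-forces {σ} refl forces = forces (Unique.allFin⁺ n)
      (subst (R * σ <_) (sym (length-tabulate id)) (+-cancelʳ-< R _ _
        (≤-<-trans (≤-reflexive (trans (+-comm (R * σ) R) (trans (sym (*-suc R σ)) (*-comm R (suc σ))))) sR<)))

    red-clique : Dec (s < q * suc k) → RedClique (suc R) (allFin n)
    red-clique (no s≮) = from-forces {m + q} (trans m+q≡ (≤-antisym (≮⇒≥ s≮) s≤))
                                     (forces-sparse apart≤ ≤-refl noPath R)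
      where
      -- This is k q - 1: for s = q (k + 1) the second ceiling gives c ≤ k q.
      m = p + k′ * q
      m+q≡ : suc m + q ≡ q * suc k
      m+q≡ = rearrange p k′
        where
        rearrange : ∀ p k′ → suc (p + k′ * suc p) + suc p ≡ suc p * suc (suc k′)
        rearrange = solve-∀
      apart≤ : ∀ v {l} → Unique l → All (Apart v) l → length l ≤ m
      apart≤ v uniq apart = s≤s⁻¹ (≤-trans (apart<c v uniq apart)
        (s≤s⁻¹ (*-cancelʳ-< (suc k) c (2 + m) (begin-strict
          c * suc k                 <⟨ c< ⟩
          k * s + suc k             ≤⟨ +-monoˡ-≤ (suc k) (*-monoʳ-≤ k s≤) ⟩
          k * (q * suc k) + suc k   ≡⟨ rearrange k q ⟩
          suc (k * q) * suc k       ∎))))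
        where
        open ≤-Reasoning
        rearrange : ∀ k q → k * (q * suc k) + suc k ≡ suc (k * q) * suc k
        rearrange = solve-∀
    red-clique (yes s<) = from-forces (trans (sym (+-suc m p)) s≡) (forces-dense R)
      where
      open ≤-Reasoning
      q≤s : q ≤ s
      q≤s = ≤-trans (m≤m*n q k) (<⇒≤ qk<s)
      m = s ∸ q
      s≡ : m + q ≡ s
      s≡ = m∸n+n≡m q≤s
      -- Here k ≥ t - 3 enters, as p ≤ k + 1: if s < c + p, the bound on c gives s < p (k + 1) ≤ q k
      -- + 1, against q k < s.
      c+p≤s : c + p ≤ s
      c+p≤s = ≮⇒≥ λ s<c+p → <⇒≱ (begin-strict
        suc (q * k)             ≤⟨ qk<s ⟩
        s                       <⟨ +-cancelˡ-< (k * s + suc k) _ _ (begin-strict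
          k * s + suc k + s              ≡⟨ rearrange k s ⟩
          suc s * suc k                  ≤⟨ *-monoˡ-≤ (suc k) s<c+p ⟩
          (c + p) * suc k                ≡⟨ *-distribʳ-+ (suc k) c p ⟩
          c * suc k + p * suc k          <⟨ +-monoˡ-< (p * suc k) c< ⟩
          k * s + suc k + p * suc k      ∎) ⟩
        p * suc k               ≡⟨ *-suc p k ⟩
        p + p * k               ∎) (+-monoˡ-≤ (p * k) p≤1+k)
        where
        rearrange : ∀ k s → k * s + suc k + s ≡ suc s * suc k
        rearrange = solve-∀
      apart≤ : ∀ v {l} → Unique l → All (Apart v) l → length l ≤ m
      apart≤ v {l} uniq apart = m+n≤o⇒m≤o∸n (length l) (begin
        length l + suc p  ≡⟨ +-suc (length l) p ⟩
        suc (length l) + p ≤⟨ +-monoˡ-≤ p (apart<c v uniq apart) ⟩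
        c + p             ≤⟨ c+p≤s ⟩
        s                 ∎)
      q∤m : ¬ q ∣ m
      -- Otherwise q divides s = m + q, which lies strictly between the consecutive multiples q k
      -- and q (k + 1).
      q∤m q∣m with subst (q ∣_) s≡ (∣m∣n⇒∣m+n q∣m ∣-refl)
      ... | divides e refl = <⇒≱
        (*-cancelˡ-< q e (suc k) (subst (_< q * suc k) (*-comm e q) s<))
        (*-cancelˡ-< q k e (subst (q * k <_) (*-comm e q) qk<s))
      open CliqueCase apart≤ noPath q∤m

i-j≤k⇒i≤k+j : ∀ {n c d} → + n ℤ.- + c ℤ.≤ + d → n ≤ d + c
i-j≤k⇒i≤k+j {n} {c} {d} le = ℤ.drop‿+≤+ (subst (ℤ._≤ + (d + c)) (cancel (+ n) (+ c)) (ℤ.+-monoˡ-≤ (+ c) le))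
  where
  cancel : ∀ n c → n ℤ.- c ℤ.+ c ≡ n
  cancel = ℤRing.solve-∀

theorem1p3 : (r t k n : ℕ) (r≥2 : r ≥ 2) → t ≥ 2 → k ≥ 1 → k ≥ t ∸ 3 →
    (G : Graph n) →
    (r ∸ 1) * (t ∸ 1) * k < n →
    n ≤ (r ∸ 1) * (t ∸ 1) * (k + 1) →
    + δ G ℤ.≥ + n ℤ.- ceiling ((+ k / suc k) ℚᵘ.* (ceiling ((+ n / (r ∸ 1)) {{r∸1-nonZero r≥2}}) / 1)) →
    G ⟶⟨ K r , P t ⟩
theorem1p3 (suc (suc r′)) (suc (suc p)) (suc k′) n r≥2@(s≤s (s≤s _)) (s≤s (s≤s _)) k≥1 k≥t∸3 G lo hi δ≥
  with ceiling-bounds n r′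
... | s , ⌈n/R⌉≡ , n≤sR , sR<
  -- Unnormalised multiplication leaves the denominator (k + 1) * 1, which computes to
  -- `suc (suc k′ * 1)`.
  with ceiling-bounds (suc k′ * s) (suc k′ * 1)
... | c , ⌈⌉≡ , _ , c< = arrows-from-bounds r′ p k′ n (p≤1+k p k≥t∸3) G lo hi s c n≤sR sR<
  (subst (λ d → c * suc d < suc k′ * s + suc d) (*-identityʳ (suc k′)) c<)
  (i-j≤k⇒i≤k+j (subst (λ z → + n ℤ.- z ℤ.≤ + δ G) ceiling≡ δ≥))
  where
  p≤1+k : ∀ p → suc k′ ≥ p ∸ 1 → p ≤ 2 + k′
  p≤1+k zero    _ = z≤n
  p≤1+k (suc p) h = s≤s h
  ceiling≡ : ceiling ((+ suc k′ / suc (suc k′)) ℚᵘ.* (ceiling (+ n / suc r′) / 1)) ≡ + c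
  ceiling≡ = trans (cong (λ z → ceiling ((+ suc k′ / suc (suc k′)) ℚᵘ.* (z / 1))) ⌈n/R⌉≡)
    (trans (cong (λ z → ceiling (z / suc (suc k′ * 1))) (sym (ℤ.pos-* (suc k′) s))) ⌈⌉≡)
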